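{- Let $m\in\mathbb{N}$. Given any two compatible permutations $a,b\in S_m$, the corresponding partition $\beta(a,b)$ can be computed from $a$ and $b$ and belongs to $P_2(m)$; that is, $\beta$ is a well-defined map assigning an element $\beta(\alpha,b)\in P_2(m)$ to each $\alpha\in S_m$ and each $b\in U_m(\alpha)$.
   Context: $S_m$ is the symmetric group on $\{1,\dots,m\}$; a permutation $a$ is written as the sequence $(a(1)\ a(2)\ \dots\ a(m))$, where $a(i)$ is called the label at depth $i$. Two permutations $a,b\in S_m$ are compatible if $a(i)\ne b(i)$ for all $1\le i\le m$. For $\alpha\in S_m$, $C(\alpha)$ is the set of permutations in $S_m$ that are not compatible with $\alpha$, and $U_m(\alpha)=S_m\setminus C(\alpha)$ is the set of permutations compatible with $\alpha$. The partition $\beta(a,b)$ corresponding to $a$ and $b$ is the multiset of lengths of the cycles obtained by traversing labels as follows: from a label $d$, find the depth $c$ at which $d$ occurs in $a$ (so $a(c)=d$), and move to the label $b(c)$ at depth $c$ in $b$; repeat until the starting label is reached again, and do so until every label has been visited. Each such cycle contributes one part equal to its number of labels. $P_2(m)$ is the set of partitions of $m$ all of whose parts are $\ge 2$. -}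

module Defs where

open import Data.Nat using (ℕ; _<_; _≤_)
open import Data.Fin using (Fin)
open import Data.Fin.Permutation using (Permutation′; _⟨$⟩ʳ_; _⟨$⟩ˡ_)
open import Data.List using (List; []; _∷_; [_]; _++_; map; length)
open import Data.Nat.ListAction using (sum)
open import Data.List.Membership.Propositional using (_∈_; _∉_)
open import Data.List.Relation.Unary.All using (All)
open import Data.List.Relation.Binary.Permutation.Propositional using (_↭_)
open import Data.Product using (Σ-syntax; ∃-syntax; _×_)
open import Function.Bundles using (_⇔_; mk⇔)
open import Level using (0ℓ)
open import Relation.Binary.PropositionalEquality using (_≡_; _≢_)
open import Relation.Unary using (Pred; ∁)

-- Depths and labels 1,…,m are both represented by Fin m.
S : ℕ → Set
S m = Permutation′ m

Compatible : ∀ {m} → S m → S m → Set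
Compatible {m} a b = ∀ (i : Fin m) → a ⟨$⟩ʳ i ≢ b ⟨$⟩ʳ i

C : ∀ {m} → S m → Pred (S m) 0ℓ
C α = ∁ (Compatible α)

U : ∀ {m} → S m → Pred (S m) 0ℓ
U α = ∁ (C α)

-- Compatible is a negative statement, so the double complement is harmless
-- constructively.
compatible⇔U : ∀ {m} (α b : S m) → Compatible α b ⇔ U α b
compatible⇔U α b = mk⇔ (λ k ¬k → ¬k k) (λ u i eq → u (λ k → k i eq))

-- A partition is a multiset of parts: a list considered up to _↭_.
record Partition (m : ℕ) : Set where
  field
    parts    : List ℕ
    positive : All (0 <_) parts
    total    : sum parts ≡ m

open Partition public

P₂ : ℕ → Set
P₂ m = Σ[ p ∈ Partition m ] All (2 ≤_) (parts p)

module _ {m : ℕ} (a b : S m) where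

  -- a ⟨$⟩ˡ d is the depth at which d occurs in a.
  next : Fin m → Fin m
  next d = b ⟨$⟩ʳ (a ⟨$⟩ˡ d)

  -- Walk s d c: starting at d and moving by next until s is about to be
  -- reached, the labels visited are, in order, c.  The cycle of d is thus
  -- the list c with Walk d d c.
  data Walk (s : Fin m) : Fin m → List (Fin m) → Set where
    stop : ∀ {d} → next d ≡ s → Walk s d [ d ]
    move : ∀ {d c} → next d ≢ s → Walk s (next d) c → Walk s d (d ∷ c)

  -- Traversal v cs: once the labels in v have been visited, the traversal can
  -- be completed by the cycles cs.  The unvisited label from which each new
  -- cycle starts is arbitrary.
  data Traversal (v : List (Fin m)) : List (List (Fin m)) → Set where
    done  : (∀ d → d ∈ v) → Traversal v []
    cycle : ∀ {d c cs} → d ∉ v → Walk d d c → Traversal (c ++ v) cs →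
            Traversal v (c ∷ cs)

  CycleLengths : List ℕ → Set
  CycleLengths ps = ∃[ cs ] Traversal [] cs × ps ↭ map length cs

{-# OPTIONS --safe #-}
-- From a label d the successor map, being injective on a finite set, returns
-- to d, so cycles exist; a cycle through two points visits the same labels
-- from either of them, so any two decompositions of the labels into cycles
-- agree up to the order of the cycles and rotation within each cycle.
module Submission where

open import Defs
open import Data.Nat using (ℕ; zero; suc; _+_; _≤_; _<_; z≤n; s≤s)
open import Data.Nat.GeneralisedArithmetic using (fold; iterate; iterate-is-fold)
open import Data.Nat.ListAction using (sum)
open import Data.Nat.Properties using (≤-refl; ≤-trans; m≤n⇒m≤1+n; <-irrefl; n<1+n)
open import Data.Fin using (Fin; toℕ)
open import Data.Fin.Permutation using (_≈_; _⟨$⟩ʳ_; _⟨$⟩ˡ_; inverseˡ; inverseʳ)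
open import Data.Fin.Properties using (_≟_; pigeonhole)
open import Data.List using (List; []; _∷_; _++_; map; length; concat; allFin)
open import Data.List.Membership.DecPropositional using (_∈?_)
import Data.List.Membership.Propositional as List
open import Data.List.Membership.Propositional.Properties
  using (∈-allFin; ∈-concat⁻′; ∈-∃++; ∈-++⁺ˡ; ∈-++⁺ʳ; ∈-++⁻)
open import Data.List.Membership.Propositional.Properties.WithK using (unique∧set⇒bag)
open import Data.List.Properties using (length-++; length-tabulate; ++-identityʳ)
open import Data.List.Relation.Binary.BagAndSetEquality using (∼bag⇒↭)
open import Data.List.Relation.Binary.Permutation.Propositional
  using (_↭_; refl; prep; swap; trans; ↭-refl; ↭-sym; ↭-trans; ↭-reflexive; module PermutationReasoning)
open import Data.List.Relation.Binary.Permutation.Propositional.Properties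
  using (All-resp-↭; ∈-resp-↭; ++⁺ˡ; ++⁺ʳ; ++-assoc; drop-∷; map⁺; shift; shifts; ↭-length; ¬x∷xs↭[])
open import Data.List.Relation.Unary.All as All using (All; []; _∷_)
import Data.List.Relation.Unary.All.Properties as All
open import Data.List.Relation.Unary.AllPairs using ([]; _∷_)
open import Data.List.Relation.Unary.Any using (here; there)
open import Data.List.Relation.Unary.Unique.Propositional using (Unique)
import Data.List.Relation.Unary.Unique.Propositional.Properties as Unique
open import Data.Product using (Σ-syntax; ∃-syntax; _×_; _,_; proj₁; proj₂)
open import Data.Sum using (_⊎_; inj₁; inj₂; [_,_]′)
open import Function using (_∘_; id; Equivalence; mk⇔; Injective)
open import Relation.Binary.PropositionalEquality as ≡ using (_≡_; _≢_; cong; subst)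
open import Relation.Nullary using (yes; no; contradiction)
open import Relation.Unary using (_∈_; _⊆_; Pred)

-- Lists as multisets, and iteration of an injective map.

module _ {A : Set} where

  concat⁺-↭ : {xss yss : List (List A)} → xss ↭ yss → concat xss ↭ concat yss
  concat⁺-↭ refl           = ↭-refl
  concat⁺-↭ (prep xs p)    = ++⁺ˡ xs (concat⁺-↭ p)
  concat⁺-↭ (swap xs ys p) = ↭-trans (shifts xs ys) (++⁺ˡ ys (++⁺ˡ xs (concat⁺-↭ p)))
  concat⁺-↭ (trans p q)    = ↭-trans (concat⁺-↭ p) (concat⁺-↭ q)

  ++-cancelˡ-↭ : ∀ xs {ys zs : List A} → xs ++ ys ↭ xs ++ zs → ys ↭ zs
  ++-cancelˡ-↭ []       p = p
  ++-cancelˡ-↭ (x ∷ xs) p = ++-cancelˡ-↭ xs (drop-∷ p)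

  sum-map-length : (xss : List (List A)) → sum (map length xss) ≡ length (concat xss)
  sum-map-length []         = ≡.refl
  sum-map-length (xs ∷ xss) =
    ≡.trans (cong (length xs +_) (sum-map-length xss)) (≡.sym (length-++ xs))

  -- Without repetitions every multiplicity is 0 or 1, so membership alone determines the multiset.
  unique∧set⇒↭ : {xs ys : List A} → Unique xs → Unique ys →
                 (List._∈ xs) ⊆ (List._∈ ys) → (List._∈ ys) ⊆ (List._∈ xs) → xs ↭ ys
  unique∧set⇒↭ u v i j = ∼bag⇒↭ (unique∧set⇒bag u v (mk⇔ i j))

  -- Injectivity strips one `f` from both sides until the left one is `x` itself. A collision of
  -- iterates thus gives a return to the starting point, after `j - i` steps.
  fold-cancel : {f : A → A} → Injective _≡_ _≡_ f → ∀ x {i j} → i < j →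
                fold x f i ≡ fold x f j → ∃[ k ] fold x f (suc k) ≡ x
  fold-cancel inj x {zero}  {suc j} _         eq = j , ≡.sym eq
  fold-cancel inj x {suc i} {suc j} (s≤s i<j) eq = fold-cancel inj x i<j (inj eq)

injective⇒periodic : ∀ {m} {f : Fin m → Fin m} → Injective _≡_ _≡_ f →
                     ∀ x → ∃[ k ] iterate f x (suc k) ≡ x
injective⇒periodic {m} {f} inj x
  -- The iterates with exponents 0 to `m` take at most `m` values, so two of them coincide.
  with i , j , i<j , eq ← pigeonhole (n<1+n m) (fold x f ∘ toℕ)
  with k , eq′ ← fold-cancel inj x i<j eq
  -- `fold` applies `f` on the outside, where injectivity can cancel it; `iterate` applies it to the
  -- starting point first, as a walk does.
  = k , ≡.trans (≡.sym (iterate-is-fold x f (suc k))) eq′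

-- `≈` compares only the forward maps, while `next` also uses an inverse.
⟨$⟩ˡ-cong : ∀ {m} (π ρ : S m) → π ≈ ρ → ∀ i → π ⟨$⟩ˡ i ≡ ρ ⟨$⟩ˡ i
⟨$⟩ˡ-cong π ρ π≈ρ i = begin
  π ⟨$⟩ˡ i                      ≡⟨ inverseˡ ρ ⟨
  ρ ⟨$⟩ˡ (ρ ⟨$⟩ʳ (π ⟨$⟩ˡ i))    ≡⟨ cong (ρ ⟨$⟩ˡ_) (π≈ρ (π ⟨$⟩ˡ i)) ⟨
  ρ ⟨$⟩ˡ (π ⟨$⟩ʳ (π ⟨$⟩ˡ i))    ≡⟨ cong (ρ ⟨$⟩ˡ_) (inverseʳ π) ⟩
  ρ ⟨$⟩ˡ i                      ∎
  where open ≡.≡-Reasoning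

⟨$⟩ʳ-injective : ∀ {m} (π : S m) → Injective _≡_ _≡_ (π ⟨$⟩ʳ_)
⟨$⟩ʳ-injective π eq =
  ≡.trans (≡.sym (inverseˡ π)) (≡.trans (cong (π ⟨$⟩ˡ_) eq) (inverseˡ π))

⟨$⟩ˡ-injective : ∀ {m} (π : S m) → Injective _≡_ _≡_ (π ⟨$⟩ˡ_)
⟨$⟩ˡ-injective π eq =
  ≡.trans (≡.sym (inverseʳ π)) (≡.trans (cong (π ⟨$⟩ʳ_) eq) (inverseʳ π))

-- Walks and cycles of a fixed pair of permutations.

module _ {m : ℕ} (a b : S m) where

  private
    f : Fin m → Fin m
    f = next a b

  Closed : Pred (Fin m) _ → Set
  Closed P = ∀ {x} → P x → P (f x)

  IsCycle : List (Fin m) → Set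
  IsCycle c = ∃[ d ] Walk a b d d c

  next-injective : Injective _≡_ _≡_ f
  next-injective = ⟨$⟩ˡ-injective a ∘ ⟨$⟩ʳ-injective b

  -- The walk stops at the first arrival at `s`, so `n` only bounds its length. The `suc` forces one
  -- step before the first test, which matters when `s` is `d`.
  iterate⇒walk : ∀ {s} n d → iterate f d (suc n) ≡ s → ∃[ c ] Walk a b s d c
  iterate⇒walk zero    d eq = _ , stop eq
  iterate⇒walk {s} (suc n) d eq with f d ≟ s
  ... | yes fd≡s = _ , stop fd≡s
  ... | no  fd≢s = _ , move fd≢s (proj₂ (iterate⇒walk n (f d) eq))

  cycle-exists : ∀ d → ∃[ c ] Walk a b d d c
  cycle-exists d with k , eq ← injective⇒periodic next-injective d = iterate⇒walk k d eq

  source∈walk : ∀ {s d c} → Walk a b s d c → d List.∈ c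
  source∈walk (stop _)   = here ≡.refl
  source∈walk (move _ _) = here ≡.refl

  -- Only the last label can have its successor outside `c`, and there the successor is the target.
  walk-next : ∀ {s d c x} → Walk a b s d c → x List.∈ c → f x List.∈ c ⊎ f x ≡ s
  walk-next (stop eq)  (here ≡.refl) = inj₂ eq
  walk-next (move _ w) (here ≡.refl) = inj₁ (there (source∈walk w))
  walk-next (move _ w) (there x∈c) with walk-next w x∈c
  ... | inj₁ fx∈c = inj₁ (there fx∈c)
  ... | inj₂ fx≡s = inj₂ fx≡s

  cycle-closed : ∀ {d c} → Walk a b d d c → Closed (List._∈ c)
  cycle-closed w x∈c with walk-next w x∈c
  ... | inj₁ fx∈c   = fx∈c
  ... | inj₂ ≡.refl = source∈walk w

  walk⊆closed : ∀ {P s d c} → Closed P → Walk a b s d c → P d → (List._∈ c) ⊆ P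
  walk⊆closed cl (stop _)   Pd (here ≡.refl) = Pd
  walk⊆closed cl (move _ w) Pd (here ≡.refl) = Pd
  walk⊆closed cl (move _ w) Pd (there x∈c)   = walk⊆closed cl w (cl Pd) x∈c

  -- `P` propagates from `x` along the rest of the walk, whose last step leads to `s`. For a cycle,
  -- `s` is its start.
  closed-target : ∀ {P s d c x} → Closed P → Walk a b s d c → x List.∈ c → P x → P s
  closed-target {P} cl (stop eq) (here ≡.refl) Px = subst P eq (cl Px)
  closed-target cl (move _ w) (here ≡.refl) Px = closed-target cl w (source∈walk w) (cl Px)
  closed-target cl (move _ w) (there x∈c)   Px = closed-target cl w x∈c Px

  -- The tests carried by `stop` and `move` exclude each other.
  walk-deterministic : ∀ {s d c c′} → Walk a b s d c → Walk a b s d c′ → c ≡ c′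
  walk-deterministic (stop _)    (stop _)     = ≡.refl
  walk-deterministic (stop eq)   (move neq _) = contradiction eq neq
  walk-deterministic (move neq _) (stop eq)   = contradiction eq neq
  walk-deterministic (move _ w)  (move _ w′)  = cong (_ ∷_) (walk-deterministic w w′)

  walk-suffix : ∀ {s d c x} → Walk a b s d c → x List.∈ c →
                ∃[ c′ ] Walk a b s x c′ × length c′ ≤ length c
  walk-suffix w@(stop _)   (here ≡.refl) = _ , w , ≤-refl
  walk-suffix w@(move _ _) (here ≡.refl) = _ , w , ≤-refl
  walk-suffix (move _ w) (there x∈c) with c′ , w′ , le ← walk-suffix w x∈c
    = c′ , w′ , m≤n⇒m≤1+n le

  -- A repeated label would start two walks to s of different lengths.
  walk-unique : ∀ {s d c} → Walk a b s d c → Unique c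
  walk-unique (stop _) = [] ∷ []
  walk-unique {d = d} v@(move {c = c} _ w) = All.¬Any⇒All¬ c d∉c ∷ walk-unique w
    where
    d∉c : d List.∉ c
    d∉c d∈c with c′ , w′ , le ← walk-suffix w d∈c with ≡.refl ← walk-deterministic v w′
      = <-irrefl ≡.refl le

  -- By closedness of each cycle under `next`, the common label puts the start of the other cycle
  -- into it, and then all labels of that cycle.
  cycle-↭ : ∀ {c c′ x} → IsCycle c → IsCycle c′ → x List.∈ c → x List.∈ c′ → c ↭ c′
  cycle-↭ {x = x} (_ , w) (_ , w′) x∈c x∈c′ =
    unique∧set⇒↭ (walk-unique w) (walk-unique w′) (incl w w′ x∈c x∈c′) (incl w′ w x∈c′ x∈c)
    where
    incl : ∀ {d d′ c c′} → Walk a b d d c → Walk a b d′ d′ c′ →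
           x List.∈ c → x List.∈ c′ → (List._∈ c) ⊆ (List._∈ c′)
    incl w w′ x∈c x∈c′ =
      walk⊆closed (cycle-closed w′) w (closed-target (cycle-closed w′) w x∈c x∈c′)

  -- Induction on `cs`: the first cycle is matched with the cycle of `ds` that contains its start,
  -- and both are removed.
  cycle-lengths-unique : ∀ {cs ds} → All IsCycle cs → All IsCycle ds →
                         concat cs ↭ concat ds → map length cs ↭ map length ds
  cycle-lengths-unique []      []                      p = ↭-refl
  -- Splitting on the walk exposes a first label, so the concatenation of `ds` cannot be empty.
  cycle-lengths-unique []      ((_ , stop _) ∷ _)      p = contradiction (↭-sym p) ¬x∷xs↭[]
  cycle-lengths-unique []      ((_ , move _ _) ∷ _)    p = contradiction (↭-sym p) ¬x∷xs↭[]
  cycle-lengths-unique {c ∷ cs} {ds} (h@(d , w) ∷ hs) ks p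
    with c′ , d∈c′ , c′∈ds ← ∈-concat⁻′ ds (∈-resp-↭ p (∈-++⁺ˡ (source∈walk w)))
    with ys , zs , ≡.refl ← ∈-∃++ c′∈ds
    with k ∷ ks′ ← All-resp-↭ (shift c′ ys zs) ks
    = begin
      (length c ∷ map length cs)           ≡⟨ cong (_∷ map length cs) (↭-length c↭c′) ⟩
      length c′ ∷ map length cs            ↭⟨ prep (length c′) (cycle-lengths-unique hs ks′ rest) ⟩
      length c′ ∷ map length (ys ++ zs)    ↭⟨ map⁺ length (shift c′ ys zs) ⟨
      map length (ys ++ c′ ∷ zs)           ∎
    where
    open PermutationReasoning
    c↭c′ : c ↭ c′
    c↭c′ = cycle-↭ h k (source∈walk w) d∈c′
    rest : concat cs ↭ concat (ys ++ zs)
    -- With `c′` moved to the front and `c` replaced by its rearrangement `c′`, the same block can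
    -- be cancelled on both sides.
    rest = ++-cancelˡ-↭ c′ (begin
      c′ ++ concat cs            ↭⟨ ++⁺ʳ (concat cs) c↭c′ ⟨
      c ++ concat cs             ↭⟨ p ⟩
      concat (ys ++ c′ ∷ zs)     ↭⟨ concat⁺-↭ (shift c′ ys zs) ⟩
      c′ ++ concat (ys ++ zs)    ∎)

  -- Traversals: exhaustion of the labels, and existence.

  traversal-cycles : ∀ {v cs} → Traversal a b v cs → All IsCycle cs
  traversal-cycles (done _)      = []
  traversal-cycles (cycle _ w t) = (_ , w) ∷ traversal-cycles t

  -- A new cycle avoids v because a closed v meeting it would contain its start.
  traversal-↭ : ∀ {v cs} → Closed (List._∈ v) → Unique v → Traversal a b v cs →
                concat cs ++ v ↭ allFin m
  traversal-↭ cl u (done all) =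
    unique∧set⇒↭ u (Unique.allFin⁺ m) (λ _ → ∈-allFin _) (λ _ → all _)
  traversal-↭ {v} {c ∷ cs} cl u (cycle d∉v w t) = begin
    (c ++ concat cs) ++ v    ↭⟨ ++-assoc c (concat cs) v ⟩
    c ++ concat cs ++ v      ↭⟨ shifts c (concat cs) ⟩
    concat cs ++ c ++ v      ↭⟨ traversal-↭ cl′ u′ t ⟩
    allFin m                 ∎
    where
    open PermutationReasoning
    u′ : Unique (c ++ v)
    u′ = Unique.++⁺ (walk-unique w) u (λ (x∈c , x∈v) → d∉v (closed-target cl w x∈c x∈v))
    cl′ : Closed (List._∈ (c ++ v))
    cl′ = [ ∈-++⁺ˡ ∘ cycle-closed w , ∈-++⁺ʳ c ∘ cl ]′ ∘ ∈-++⁻ c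

  traversal-concat-↭ : ∀ {cs} → Traversal a b [] cs → concat cs ↭ allFin m
  traversal-concat-↭ {cs} t =
    ↭-trans (↭-reflexive (≡.sym (++-identityʳ (concat cs)))) (traversal-↭ (λ ()) [] t)

  -- `xs` holds the candidate starts still to be tried; the invariant `cover` says that everything
  -- else is visited, so the traversal is complete once `xs` is empty.
  extend-traversal : ∀ xs {v} → (∀ d → d List.∈ v ⊎ d List.∈ xs) → ∃[ cs ] Traversal a b v cs
  extend-traversal []       cover = [] , done λ d → [ id , (λ ()) ]′ (cover d)
  extend-traversal (x ∷ xs) {v} cover with _∈?_ _≟_ x v
  ... | yes x∈v = extend-traversal xs λ d → shrink (cover d)
    where
    shrink : ∀ {d} → d List.∈ v ⊎ d List.∈ (x ∷ xs) → d List.∈ v ⊎ d List.∈ xs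
    shrink (inj₁ d∈v)            = inj₁ d∈v
    shrink (inj₂ (here ≡.refl))  = inj₁ x∈v
    shrink (inj₂ (there d∈xs))   = inj₂ d∈xs
  -- The whole cycle becomes visited but only `x` leaves the candidates; its other labels, if still
  -- listed, are skipped later by the `yes` branch.
  ... | no x∉v with c , w ← cycle-exists x =
    let cs , t = extend-traversal xs λ d → shrink w (cover d) in c ∷ cs , cycle x∉v w t
    where
    shrink : ∀ {c d} → Walk a b x x c → d List.∈ v ⊎ d List.∈ (x ∷ xs) →
            d List.∈ (c ++ v) ⊎ d List.∈ xs
    shrink {c} w (inj₁ d∈v)           = inj₁ (∈-++⁺ʳ c d∈v)
    shrink w (inj₂ (here ≡.refl)) = inj₁ (∈-++⁺ˡ (source∈walk w))
    shrink w (inj₂ (there d∈xs))  = inj₂ d∈xs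

  traversal-exists : ∃[ cs ] Traversal a b [] cs
  traversal-exists = extend-traversal (allFin m) (inj₂ ∘ ∈-allFin)

  -- The partition of a compatible pair.

  next-≢ : Compatible a b → ∀ d → f d ≢ d
  -- At the depth of `d` in `a`, a fixed label `d` would occur in both permutations.
  next-≢ compat d fd≡d = compat (a ⟨$⟩ˡ d) (≡.trans (inverseʳ a) (≡.sym fd≡d))

  cycle-length≥2 : Compatible a b → ∀ {c} → IsCycle c → 2 ≤ length c
  -- A cycle with a single label is a fixed point of `next`.
  cycle-length≥2 compat (d , stop eq)           = contradiction eq (next-≢ compat d)
  cycle-length≥2 compat (d , move _ (stop _))   = s≤s (s≤s z≤n)
  cycle-length≥2 compat (d , move _ (move _ _)) = s≤s (s≤s z≤n)

  cycleLengths-unique : ∀ {ps qs} → CycleLengths a b ps → CycleLengths a b qs → ps ↭ qs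
  cycleLengths-unique {ps} {qs} (cs , t , p) (ds , t′ , q) = begin
    ps               ↭⟨ p ⟩
    map length cs    ↭⟨ cycle-lengths-unique (traversal-cycles t) (traversal-cycles t′)
                          (↭-trans (traversal-concat-↭ t) (↭-sym (traversal-concat-↭ t′))) ⟩
    map length ds    ↭⟨ q ⟨
    qs               ∎
    where open PermutationReasoning

  cyclePartition : Compatible a b → P₂ m
  cyclePartition compat =
    record
      { parts    = map length cs
      ; positive = All.map (≤-trans (s≤s z≤n)) parts≥2
      -- The lengths add up to that of the concatenation, which rearranges `allFin m`.
      ; total    = ≡.trans (sum-map-length cs)
                     (≡.trans (↭-length (traversal-concat-↭ t)) (length-tabulate id))
      } , parts≥2
    where
    cs = proj₁ traversal-exists
    t  = proj₂ traversal-exists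
    parts≥2 : All (2 ≤_) (map length cs)
    parts≥2 = All.map⁺ (All.map (cycle-length≥2 compat) (traversal-cycles t))

-- Invariance under pointwise equality of permutations.

module _ {m : ℕ} {a a′ b b′ : S m} (a≈a′ : a ≈ a′) (b≈b′ : b ≈ b′) where

  next-cong : ∀ d → next a b d ≡ next a′ b′ d
  next-cong d = ≡.trans (b≈b′ _) (cong (b′ ⟨$⟩ʳ_) (⟨$⟩ˡ-cong a a′ a≈a′ d))

  walk-cong : ∀ {s d c} → Walk a b s d c → Walk a′ b′ s d c
  walk-cong (stop {d} eq) = stop (≡.trans (≡.sym (next-cong d)) eq)
  walk-cong {s} (move {d} {c} neq w) =
    -- The remaining walk starts at `next a b d`, whereas `move` for the new pair expects
    -- `next a′ b′ d`.
    move (neq ∘ ≡.trans (next-cong d)) (subst (λ e → Walk a′ b′ s e c) (next-cong d) (walk-cong w))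

  traversal-cong : ∀ {v cs} → Traversal a b v cs → Traversal a′ b′ v cs
  traversal-cong (done all)      = done all
  traversal-cong (cycle d∉v w t) = cycle d∉v (walk-cong w) (traversal-cong t)

  cycleLengths-cong : ∀ {ps} → CycleLengths a b ps → CycleLengths a′ b′ ps
  cycleLengths-cong (cs , t , p) = cs , traversal-cong t , p

-- An element of `S m` also carries an inverse and proofs, so the same permutation may have
-- different representatives; the last clause makes `β` a map on permutations themselves, with
-- values taken as multisets.
theorem40 : (m : ℕ) →
    Σ[ β ∈ ((α b : S m) → b ∈ U α → P₂ m) ]
    ((α b : S m) (u : b ∈ U α) → CycleLengths α b (parts (proj₁ (β α b u))))
    × ((α b : S m) (u : b ∈ U α) (ps : List ℕ) → CycleLengths α b ps → ps ↭ parts (proj₁ (β α b u)))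
    × ((α α′ b b′ : S m) (u : b ∈ U α) (u′ : b′ ∈ U α′) → α ≈ α′ → b ≈ b′ → parts (proj₁ (β α b u)) ↭ parts (proj₁ (β α′ b′ u′)))
theorem40 m = β , computes , unique , respects
  where
  β : (α b : S m) → b ∈ U α → P₂ m
  β α b u = cyclePartition α b (Equivalence.from (compatible⇔U α b) u)

  computes : ∀ α b (u : b ∈ U α) → CycleLengths α b (parts (proj₁ (β α b u)))
  computes α b u = proj₁ (traversal-exists α b) , proj₂ (traversal-exists α b) , ↭-refl

  unique : ∀ α b (u : b ∈ U α) ps → CycleLengths α b ps → ps ↭ parts (proj₁ (β α b u))
  unique α b u ps h = cycleLengths-unique α b h (computes α b u)

  respects : ∀ α α′ b b′ (u : b ∈ U α) (u′ : b′ ∈ U α′) → α ≈ α′ → b ≈ b′ →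
             parts (proj₁ (β α b u)) ↭ parts (proj₁ (β α′ b′ u′))
  respects α α′ b b′ u u′ α≈α′ b≈b′ =
    -- The cycle lengths found for the first pair are also cycle lengths for the second, where
    -- uniqueness applies.
    unique α′ b′ u′ _ (cycleLengths-cong α≈α′ b≈b′ (computes α b u))
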